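{- Let $\mathbf{A}\in\mathbb{R}^{n\times n}$ be a symmetric positive semidefinite matrix all of whose rows and columns have Euclidean norm one, let $k\ge 1$ be an integer (the sparsity parameter) and let $\varepsilon>0$ be an error tolerance. Let $\mathbf{Z}$ be an optimal solution of the semidefinite program $$\max_{\mathbf{Z}\in\mathbb{R}^{n\times n},\ \mathbf{Z}\succeq 0}\ \mathrm{Tr}(\mathbf{A}\mathbf{Z})\quad\text{subject to}\quad \mathrm{Tr}(\mathbf{Z})\le 1,\quad \sum_{i,j}|Z_{i,j}|\le k,$$ and let $\mathbf{Z}_1$ be the best rank-one approximation to $\mathbf{Z}$. Suppose $\alpha\ge 1$ is a constant such that $\mathrm{Tr}(\mathbf{A}\mathbf{Z})\le\alpha\,\mathrm{Tr}(\mathbf{A}\mathbf{Z}_1)$ and $\beta$ is a constant such that $\beta\ge \|\mathbf{Z}_1\|_1/\|\mathbf{Z}\|_1$, and that $s:=9k^2\beta^2/\varepsilon^2$ is an integer. Write $\mathbf{Z}_1=\mathbf{u}\mathbf{u}^\top$ with $\mathbf{u}\in\mathbb{R}^n$, and let $\mathbf{z}\in\mathbb{R}^n$ be the vector that agrees with $\mathbf{u}$ on the $s$ coordinates of $\mathbf{u}$ of largest absolute value (on all coordinates, if $s\ge n$) and is zero elsewhere. Then $$\|\mathbf{z}\|_0\le\frac{9k^2\beta^2}{\varepsilon^2},\qquad \|\mathbf{z}\|_2\le 1,\qquad \mathbf{z}^\top\mathbf{A}\mathbf{z}\ \ge\ \frac{1}{\alpha}\,\mathcal{Z}^*-\varepsilon,$$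 where $\mathcal{Z}^*=\max\{\mathbf{x}^\top\mathbf{A}\mathbf{x}:\ \mathbf{x}\in\mathbb{R}^n,\ \|\mathbf{x}\|_2\le 1,\ \|\mathbf{x}\|_0\le k\}$.
   Context: $\|\mathbf{x}\|_0$ is the number of non-zero entries of $\mathbf{x}$; for a matrix $\mathbf{M}$, $\|\mathbf{M}\|_1=\sum_{i,j}|M_{i,j}|$ is the entrywise $1$-norm; $\mathbf{Z}\succeq 0$ means symmetric positive semidefinite. The best rank-one approximation of the PSD matrix $\mathbf{Z}$ is $\mathbf{Z}_1=\lambda_1\mathbf{v}_1\mathbf{v}_1^\top$, where $\lambda_1$ is the largest eigenvalue of $\mathbf{Z}$ and $\mathbf{v}_1$ a corresponding unit eigenvector (any choice if not unique), so that $\mathbf{u}=\sqrt{\lambda_1}\,\mathbf{v}_1$ up to sign. Ties in choosing the coordinates of largest absolute value are broken arbitrarily. The vector $\mathbf{z}$ is the output of the paper's algorithm \texttt{spca-sdp} on input $(\mathbf{A},k,\varepsilon)$. -}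

module Defs where

open import Level using (0ℓ) renaming (suc to lsuc)
open import Algebra.Bundles using (CommutativeRing; Semiring)
import Algebra.Construct.NaturalChoice.Max as Max
import Algebra.Definitions.RawSemiring as RawSemiringDefinitions
import Algebra.Properties.Ring as RingProperties
open import Data.Fin.Base using (Fin)
open import Data.Fin.Subset using (Subset; _∈_; _∉_; ∣_∣)
open import Data.Nat.Base as ℕ using (ℕ)
open import Data.Product.Base using (_×_; _,_; ∃-syntax; proj₁)
open import Data.Sum.Base using (_⊎_; inj₁; inj₂)
open import Data.Vec.Base using (count; tabulate)
open import Data.Vec.Functional using (Vector)
open import Relation.Binary.Bundles using (TotalOrder)
open import Relation.Binary.Core using (Rel)
import Relation.Binary.Construct.NonStrictToStrict as Strict
open import Relation.Binary.PropositionalEquality.Core using (_≡_)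
import Relation.Binary.Reasoning.Setoid as SetoidReasoning
open import Relation.Binary.Structures using (IsDecTotalOrder)
open import Relation.Nullary using (¬_; yes; no)
open import Relation.Nullary.Decidable using (¬?)
open import Relation.Unary using (Pred; Satisfiable)

-- The real numbers, given by their second-order axioms: a Dedekind-complete
-- totally ordered field.  The reading is classical (the order and equality are
-- decidable, suprema are given for arbitrary predicates); classically these
-- axioms have exactly one model up to isomorphism.
record CompleteOrderedField : Set (lsuc 0ℓ) where
  field
    commutativeRing : CommutativeRing 0ℓ 0ℓ

  open CommutativeRing commutativeRing public

  infix 4 _≤_

  field
    _≤_             : Rel Carrier 0ℓ
    isDecTotalOrder : IsDecTotalOrder _≈_ _≤_
    0≉1             : 0# ≉ 1#
    inverse         : ∀ x → x ≉ 0# → ∃[ y ] x * y ≈ 1#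
    +-monoʳ-≤       : ∀ x {y z} → y ≤ z → x + y ≤ x + z
    *-nonNeg        : ∀ {x y} → 0# ≤ x → 0# ≤ y → 0# ≤ x * y

  IsUpperBound : Pred Carrier 0ℓ → Pred Carrier 0ℓ
  IsUpperBound S b = ∀ x → S x → x ≤ b

  IsSupremum : Pred Carrier 0ℓ → Pred Carrier 0ℓ
  IsSupremum S m = IsUpperBound S m × (∀ b → IsUpperBound S b → m ≤ b)

  field
    supremum : ∀ S → Satisfiable S → Satisfiable (IsUpperBound S) →
               Satisfiable (IsSupremum S)

module RealArithmetic (ℝ : CompleteOrderedField) where

  open CompleteOrderedField ℝ public
  open Strict _≈_ _≤_ public using (_<_)
  open RawSemiringDefinitions (Semiring.rawSemiring semiring) public
    using (sum; _^_) renaming (_×_ to _·_)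
  module ≤ = IsDecTotalOrder isDecTotalOrder

  totalOrder : TotalOrder 0ℓ 0ℓ 0ℓ
  totalOrder = record { isTotalOrder = ≤.isTotalOrder }

  open Max totalOrder public using (_⊔_; x≤x⊔y; x≤y⊔x)

  fromℕ : ℕ → Carrier
  fromℕ m = m · 1#

  infix 4 _≥_
  _≥_ : Rel Carrier 0ℓ
  x ≥ y = y ≤ x

  ∣_∣ᵃ : Carrier → Carrier
  ∣ x ∣ᵃ = x ⊔ (- x)

  infix 8 _⁻¹
  infixl 7 _/_

  -- The value at zero is a junk value.
  _⁻¹ : Carrier → Carrier
  x ⁻¹ with x ≤.≟ 0#
  ... | yes _  = 0#
  ... | no x≉0 = proj₁ (inverse x x≉0)

  _/_ : Carrier → Carrier → Carrier
  x / y = x * y ⁻¹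

  open RingProperties ring
    using (x[y-z]≈xy-xz; -1*x≈-x; -‿involutive)

  x≤y⇒0≤y-x : ∀ {x y} → x ≤ y → 0# ≤ y - x
  x≤y⇒0≤y-x {x} {y} x≤y =
    ≤.≤-respˡ-≈ (-‿inverseˡ x)
      (≤.≤-respʳ-≈ (+-comm (- x) y) (+-monoʳ-≤ (- x) x≤y))

  0≤1 : 0# ≤ 1#
  0≤1 with ≤.total 0# 1#
  ... | inj₁ p = p
  ... | inj₂ p =
    ≤.≤-respʳ-≈ (trans (-1*x≈-x (- 1#)) (-‿involutive 1#)) (*-nonNeg 0≤-1 0≤-1)
    where
    0≤-1 : 0# ≤ - 1#
    0≤-1 = ≤.≤-respʳ-≈ (+-identityˡ (- 1#)) (x≤y⇒0≤y-x p)

  1≤y⇒y≤y*y : ∀ {y} → 1# ≤ y → y ≤ y * y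
  1≤y⇒y≤y*y {y} 1≤y =
    ≤.≤-respˡ-≈ (+-identityʳ y) (≤.≤-respʳ-≈ eq
      (+-monoʳ-≤ y (*-nonNeg (≤.trans 0≤1 1≤y) (x≤y⇒0≤y-x 1≤y))))
    where
    eq : y + y * (y - 1#) ≈ y * y
    eq = begin
      y + y * (y - 1#)      ≈⟨ +-congˡ (x[y-z]≈xy-xz y y 1#) ⟩
      y + (y * y - y * 1#)  ≈⟨ +-congˡ (+-congˡ (-‿cong (*-identityʳ y))) ⟩
      y + (y * y - y)       ≈⟨ +-congˡ (+-comm (y * y) (- y)) ⟩
      y + (- y + y * y)     ≈⟨ +-assoc y (- y) (y * y) ⟨
      (y - y) + y * y       ≈⟨ +-congʳ (-‿inverseʳ y) ⟩
      0# + y * y            ≈⟨ +-identityˡ (y * y) ⟩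
      y * y                 ∎
      where open SetoidReasoning setoid

  -- The disjunct y ≈ 0 only matters for x < 0, where it gives √ x the junk
  -- value 0; for 0 ≤ x the supremum is the nonnegative square root of x.
  SquareBelow : Carrier → Pred Carrier 0ℓ
  SquareBelow x y = y ≈ 0# ⊎ y * y ≤ x

  SquareBelow-bounded : ∀ x → IsUpperBound (SquareBelow x) (1# ⊔ x)
  SquareBelow-bounded x y (inj₁ y≈0) =
    ≤.≤-respˡ-≈ (sym y≈0) (≤.trans 0≤1 (x≤x⊔y 1# x))
  SquareBelow-bounded x y (inj₂ y²≤x) with ≤.total y 1#
  ... | inj₁ y≤1 = ≤.trans y≤1 (x≤x⊔y 1# x)
  ... | inj₂ 1≤y = ≤.trans (1≤y⇒y≤y*y 1≤y) (≤.trans y²≤x (x≤y⊔x 1# x))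

  √ : Carrier → Carrier
  √ x = proj₁ (supremum (SquareBelow x)
                        (0# , inj₁ refl)
                        (1# ⊔ x , SquareBelow-bounded x))

module SparsePCA (ℝ : CompleteOrderedField) where

  open RealArithmetic ℝ public

  Matrix : ℕ → Set
  Matrix n = Fin n → Vector Carrier n

  infix 4 _≋_
  _≋_ : ∀ {n} → Rel (Vector Carrier n) 0ℓ
  x ≋ y = ∀ i → x i ≈ y i

  0ᵛ : ∀ {n} → Vector Carrier n
  0ᵛ _ = 0#

  infixl 7 _*ₘᵥ_ _*ₘ_
  infixr 7 _*ᵥ_

  _*ᵥ_ : ∀ {n} → Carrier → Vector Carrier n → Vector Carrier n
  (c *ᵥ x) i = c * x i

  _*ₘᵥ_ : ∀ {n} → Matrix n → Vector Carrier n → Vector Carrier n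
  (M *ₘᵥ x) i = sum λ j → M i j * x j

  _*ₘ_ : ∀ {n} → Matrix n → Matrix n → Matrix n
  (M *ₘ N) i j = sum λ l → M i l * N l j

  _ᵀ : ∀ {n} → Matrix n → Matrix n
  (M ᵀ) i j = M j i

  dot : ∀ {n} → Vector Carrier n → Vector Carrier n → Carrier
  dot x y = sum λ i → x i * y i

  Tr : ∀ {n} → Matrix n → Carrier
  Tr M = sum λ i → M i i

  quadraticForm : ∀ {n} → Matrix n → Vector Carrier n → Carrier
  quadraticForm M x = dot x (M *ₘᵥ x)

  ‖_‖₀ : ∀ {n} → Vector Carrier n → ℕ
  ‖ x ‖₀ = count (λ a → ¬? (a ≤.≟ 0#)) (tabulate x)

  ‖_‖₂ : ∀ {n} → Vector Carrier n → Carrier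
  ‖ x ‖₂ = √ (sum λ i → x i ^ 2)

  -- The entrywise 1-norm, not the operator norm.
  ‖_‖₁ : ∀ {n} → Matrix n → Carrier
  ‖ M ‖₁ = sum λ i → sum λ j → ∣ M i j ∣ᵃ

  IsSymmetric : ∀ {n} → Matrix n → Set
  IsSymmetric M = ∀ i j → M i j ≈ M j i

  IsPSD : ∀ {n} → Matrix n → Set
  IsPSD M = IsSymmetric M × (∀ x → 0# ≤ quadraticForm M x)

  HasUnitRows : ∀ {n} → Matrix n → Set
  HasUnitRows M = ∀ i → ‖ M i ‖₂ ≈ 1#

  IsEigenvector : ∀ {n} → Matrix n → Carrier → Vector Carrier n → Set
  IsEigenvector M μ v = (¬ v ≋ 0ᵛ) × M *ₘᵥ v ≋ μ *ᵥ v

  IsEigenvalue : ∀ {n} → Matrix n → Carrier → Set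
  IsEigenvalue M μ = ∃[ v ] IsEigenvector M μ v

  IsLargestEigenvalue : ∀ {n} → Matrix n → Carrier → Set
  IsLargestEigenvalue M μ =
    IsEigenvalue M μ × (∀ ν → IsEigenvalue M ν → ν ≤ μ)

  IsBestRankOneApproximation : ∀ {n} → Matrix n → Matrix n → Set
  IsBestRankOneApproximation Z Z₁ =
    ∃[ λ₁ ] ∃[ v₁ ]
      IsLargestEigenvalue Z λ₁ ×
      IsEigenvector Z λ₁ v₁ ×
      ‖ v₁ ‖₂ ≈ 1# ×
      (∀ i j → Z₁ i j ≈ λ₁ * (v₁ i * v₁ j))

  -- x attains the maximum of f over the set P.
  IsMaximiser : {X : Set} → Pred X 0ℓ → (X → Carrier) → X → Set
  IsMaximiser P f x = P x × (∀ y → P y → f y ≤ f x)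

  IsMaximumValue : {X : Set} → Pred X 0ℓ → (X → Carrier) → Carrier → Set
  IsMaximumValue P f m = ∃[ x ] IsMaximiser P f x × m ≈ f x

  SDPFeasible : ∀ {n} → ℕ → Pred (Matrix n) 0ℓ
  SDPFeasible k Z = IsPSD Z × Tr Z ≤ 1# × ‖ Z ‖₁ ≤ fromℕ k

  IsSDPOptimal : ∀ {n} → Matrix n → ℕ → Matrix n → Set
  IsSDPOptimal A k = IsMaximiser (SDPFeasible k) (λ Z → Tr (A *ₘ Z))

  SPCAFeasible : ∀ {n} → ℕ → Pred (Vector Carrier n) 0ℓ
  SPCAFeasible k x = ‖ x ‖₂ ≤ 1# × ‖ x ‖₀ ℕ.≤ k

  IsSPCAValue : ∀ {n} → Matrix n → ℕ → Carrier → Set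
  IsSPCAValue A k = IsMaximumValue (SPCAFeasible k) (quadraticForm A)

  -- z keeps s largest coordinates of u in absolute value (all of them if
  -- n ≤ s).  Every choice of the support S among ties is admitted.
  IsTopTruncation : ∀ {n} → ℕ → Vector Carrier n → Vector Carrier n → Set
  IsTopTruncation {n} s u z =
    ∃[ S ] ∣ S ∣ ≡ s ℕ.⊓ n ×
      (∀ i j → i ∈ S → j ∉ S → ∣ u j ∣ᵃ ≤ ∣ u i ∣ᵃ) ×
      (∀ i → i ∈ S → z i ≈ u i) ×
      (∀ i → i ∉ S → z i ≈ 0#)

  sparsityBound : ℕ → (β ε : Carrier) → Carrier
  sparsityBound k β ε = (fromℕ 9 * fromℕ k ^ 2 * β ^ 2) / ε ^ 2

{-# OPTIONS --safe #-}

-- If x is feasible for sparse PCA then x xᵀ is feasible for the relaxation, so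
-- 𝒵* ≤ Tr(AZ) ≤ α uᵀAu, and it remains to bound the loss from u to z.  With
-- w = u − z, positivity of A gives uᵀAu ≤ zᵀAz + 2 uᵀAw, and the unit rows give
-- |(Aw)ᵢ| ≤ ‖w‖₂, so uᵀAw ≤ ‖u‖₁ ‖w‖₂.  A discarded coordinate is at most the
-- average of the s kept ones, hence s ‖w‖₂² ≤ ‖u‖₁² = ‖Z₁‖₁ ≤ kβ, and
-- 2 uᵀAw ≤ 2 ‖u‖₁²/√s ≤ 2kβ/√s = 2ε/3.
-- For a positive semidefinite M, vᵀMv ≤ Tr(M) vᵀv follows from its 2×2
-- principal minors without the spectral theorem; this yields both ‖u‖₂ ≤ 1 and,
-- for M = x xᵀ, the Cauchy–Schwarz inequality.
module Submission where

import Algebra.Construct.NaturalChoice.Max as Max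
import Algebra.Properties.Ring as RingProperties
import Algebra.Properties.Semiring.Mult as SemiringMult
import Algebra.Properties.Semiring.Sum as SemiringSum
import Algebra.Solver.Ring.NaturalCoefficients.Default as SemiringSolver
open import Data.Bool.Base using (if_then_else_; true; false)
open import Data.Fin.Base using (Fin; zero; suc)
open import Data.Fin.Subset using (Subset; inside; outside; _∈_; _∉_; ∣_∣)
open import Data.Fin.Subset.Properties using (_∈?_; drop-there; ∣p∣≡n⇒p≡⊤; ∈⊤)
open import Data.Nat.Base as ℕ using (ℕ; z≤n; s≤s)
import Data.Nat.Properties as ℕ
open import Data.Product.Base using (_×_; _,_; proj₁; proj₂)
open import Data.Sum.Base using (inj₁; inj₂; [_,_]′)
open import Data.Vec.Base using (_∷_; []; here; there)
open import Data.Vec.Functional using (Vector; updateAt)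
open import Function.Base using (_∘_; id)
open import Relation.Binary.Bundles using (Poset)
import Relation.Binary.PropositionalEquality as ≡
open ≡ using (_≡_)
import Relation.Binary.Reasoning.PartialOrder as PartialOrderReasoning
open import Relation.Nullary using (Dec; yes; no; contradiction)
open import Relation.Nullary.Decidable using (does)
open import Defs

-- Arithmetic of order, products and inverses.

module OrderedField (ℝ : CompleteOrderedField) where

  open RealArithmetic ℝ hiding (zero)
  open RingProperties ring using (-‿distribˡ-*; -‿distribʳ-*; -‿involutive)
  open SemiringMult semiring using (×1-homo-*)
  open SemiringSum semiring hiding (sum)
  open SemiringSolver commutativeSemiring using (solve; _:+_; _:*_; _:=_; con)

  poset : Poset _ _ _
  poset = record { isPartialOrder = ≤.isPartialOrder }

  module ≤-Reasoning = PartialOrderReasoning poset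
  open ≤-Reasoning

  ≈⇒≤ : ∀ {x y} → x ≈ y → x ≤ y
  ≈⇒≤ = ≤.reflexive

  +-mono-≤ : ∀ {a b c d} → a ≤ b → c ≤ d → a + c ≤ b + d
  +-mono-≤ {a} {b} {c} {d} a≤b c≤d = begin
    a + c  ≤⟨ +-monoʳ-≤ a c≤d ⟩
    a + d  ≈⟨ +-comm a d ⟩
    d + a  ≤⟨ +-monoʳ-≤ d a≤b ⟩
    d + b  ≈⟨ +-comm d b ⟩
    b + d  ∎

  +-cancelˡ-≤ : ∀ x {y z} → x + y ≤ x + z → y ≤ z
  +-cancelˡ-≤ x {y} {z} h = begin
    y              ≈⟨ cancel y ⟨
    - x + (x + y)  ≤⟨ +-monoʳ-≤ (- x) h ⟩
    - x + (x + z)  ≈⟨ cancel z ⟩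
    z              ∎
    where
    cancel : ∀ w → - x + (x + w) ≈ w
    cancel w = trans (sym (+-assoc _ _ _)) (trans (+-congʳ (-‿inverseˡ x)) (+-identityˡ w))

  x+[y-x]≈y : ∀ x y → x + (y - x) ≈ y
  x+[y-x]≈y x y = begin-equality
    x + (y - x)    ≈⟨ +-congˡ (+-comm y (- x)) ⟩
    x + (- x + y)  ≈⟨ +-assoc x (- x) y ⟨
    x - x + y      ≈⟨ +-congʳ (-‿inverseʳ x) ⟩
    0# + y         ≈⟨ +-identityˡ y ⟩
    y              ∎

  x≤x+y : ∀ x {y} → 0# ≤ y → x ≤ x + y
  x≤x+y x 0≤y = ≤.≤-respˡ-≈ (+-identityʳ x) (+-monoʳ-≤ x 0≤y)

  0≤x+y : ∀ {x y} → 0# ≤ x → 0# ≤ y → 0# ≤ x + y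
  0≤x+y {x} 0≤x 0≤y = ≤.trans 0≤x (x≤x+y x 0≤y)

  -- If `y ≤ x`, then `x + x ≤ y + y ≤ x + y`, and `x` cancels. This replaces division by two.
  x+x≤y+y⇒x≤y : ∀ {x y} → x + x ≤ y + y → x ≤ y
  x+x≤y+y⇒x≤y {x} {y} h with ≤.total x y
  ... | inj₁ x≤y = x≤y
  ... | inj₂ y≤x = +-cancelˡ-≤ x (≤.trans h (+-mono-≤ y≤x ≤.refl))

  x≤0⇒0≤-x : ∀ {x} → x ≤ 0# → 0# ≤ - x
  x≤0⇒0≤-x {x} x≤0 = ≤.≤-respʳ-≈ (+-identityˡ (- x)) (x≤y⇒0≤y-x x≤0)

  *-monoˡ-≤ : ∀ {c x y} → 0# ≤ c → x ≤ y → c * x ≤ c * y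
  *-monoˡ-≤ {c} {x} {y} 0≤c x≤y = begin
    c * x                ≤⟨ x≤x+y (c * x) (*-nonNeg 0≤c (x≤y⇒0≤y-x x≤y)) ⟩
    c * x + c * (y - x)  ≈⟨ distribˡ c x (y - x) ⟨
    c * (x + (y - x))    ≈⟨ *-congˡ (x+[y-x]≈y x y) ⟩
    c * y                ∎

  *-monoʳ-≤ : ∀ {c x y} → 0# ≤ c → x ≤ y → x * c ≤ y * c
  *-monoʳ-≤ {c} {x} {y} 0≤c x≤y = begin
    x * c  ≈⟨ *-comm x c ⟩
    c * x  ≤⟨ *-monoˡ-≤ 0≤c x≤y ⟩
    c * y  ≈⟨ *-comm c y ⟩
    y * c  ∎

  *-mono-≤ : ∀ {a b c d} → 0# ≤ b → 0# ≤ c → a ≤ b → c ≤ d → a * c ≤ b * d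
  *-mono-≤ 0≤b 0≤c a≤b c≤d = ≤.trans (*-monoʳ-≤ 0≤c a≤b) (*-monoˡ-≤ 0≤b c≤d)

  ⁻¹-inverseʳ : ∀ {x} → x ≉ 0# → x * x ⁻¹ ≈ 1#
  ⁻¹-inverseʳ {x} x≉0 with x ≤.≟ 0#
  ... | yes x≈0 = contradiction x≈0 x≉0
  ... | no  x≉0 = proj₂ (inverse x x≉0)

  ⁻¹-inverseˡ : ∀ {x} → x ≉ 0# → x ⁻¹ * x ≈ 1#
  ⁻¹-inverseˡ x≉0 = trans (*-comm _ _) (⁻¹-inverseʳ x≉0)

  *-cancelˡ : ∀ {c x y} → c ≉ 0# → c * x ≈ c * y → x ≈ y
  *-cancelˡ {c} {x} {y} c≉0 eq = begin-equality
    x               ≈⟨ cancel x ⟨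
    c ⁻¹ * (c * x)  ≈⟨ *-congˡ eq ⟩
    c ⁻¹ * (c * y)  ≈⟨ cancel y ⟩
    y               ∎
    where
    cancel : ∀ w → c ⁻¹ * (c * w) ≈ w
    cancel w = trans (sym (*-assoc _ _ _)) (trans (*-congʳ (⁻¹-inverseˡ c≉0)) (*-identityˡ w))

  -- If `y ≤ x`, then monotonicity and `h` make `c * x` and `c * y` equal, and `c` cancels from an
  -- equality.
  *-cancelˡ-≤ : ∀ {c x y} → 0# < c → c * x ≤ c * y → x ≤ y
  *-cancelˡ-≤ {c} {x} {y} (0≤c , 0≉c) h with ≤.total x y
  ... | inj₁ x≤y = x≤y
  ... | inj₂ y≤x = ≈⇒≤ (*-cancelˡ (0≉c ∘ sym) (≤.antisym h (*-monoˡ-≤ 0≤c y≤x)))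

  x*x≈0⇒x≈0 : ∀ {x} → x * x ≈ 0# → x ≈ 0#
  x*x≈0⇒x≈0 {x} eq with x ≤.≟ 0#
  ... | yes x≈0 = x≈0
  ... | no  x≉0 = *-cancelˡ x≉0 (trans eq (sym (zeroʳ x)))

  -x*-x≈x*x : ∀ x → - x * - x ≈ x * x
  -x*-x≈x*x x = begin-equality
    - x * - x      ≈⟨ -‿distribˡ-* x (- x) ⟨
    - (x * - x)    ≈⟨ -‿cong (-‿distribʳ-* x x) ⟨
    - - (x * x)    ≈⟨ -‿involutive (x * x) ⟩
    x * x          ∎

  0≤x*x : ∀ x → 0# ≤ x * x
  0≤x*x x with ≤.total 0# x
  ... | inj₁ 0≤x = *-nonNeg 0≤x 0≤x
  ... | inj₂ x≤0 = ≤.≤-respʳ-≈ (-x*-x≈x*x x) (*-nonNeg (x≤0⇒0≤-x x≤0) (x≤0⇒0≤-x x≤0))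

  -- If `y ≤ x` and `x` is nonzero, then `x * x ≤ y * y ≤ x * y`, and the positive factor `x`
  -- cancels. Comparing squares in this way replaces taking roots in the later estimates.
  x*x≤y*y⇒x≤y : ∀ {x y} → 0# ≤ y → x * x ≤ y * y → x ≤ y
  x*x≤y*y⇒x≤y {x} {y} 0≤y h with ≤.total x y
  ... | inj₁ x≤y = x≤y
  ... | inj₂ y≤x with 0# ≤.≟ x
  ...   | yes 0≈x = ≤.≤-respˡ-≈ 0≈x 0≤y
  ...   | no  0≉x = *-cancelˡ-≤ (≤.trans 0≤y y≤x , 0≉x) (≤.trans h (*-monoʳ-≤ 0≤y y≤x))

  x*x≈y*y⇒x≈y : ∀ {x y} → 0# ≤ x → 0# ≤ y → x * x ≈ y * y → x ≈ y
  x*x≈y*y⇒x≈y 0≤x 0≤y eq =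
    ≤.antisym (x*x≤y*y⇒x≤y 0≤y (≈⇒≤ eq)) (x*x≤y*y⇒x≤y 0≤x (≈⇒≤ (sym eq)))

  -- From `x * y ≈ 1#` follows `y ≈ x * (y * y)`, a product of nonnegative factors; at zero the junk
  -- value is itself nonnegative.
  0≤x⁻¹ : ∀ {x} → 0# ≤ x → 0# ≤ x ⁻¹
  0≤x⁻¹ {x} 0≤x with x ≤.≟ 0#
  ... | yes _ = ≤.refl
  ... | no x≉0 with inverse x x≉0
  ...   | y , xy≈1 = begin
    0#           ≤⟨ *-nonNeg 0≤x (0≤x*x y) ⟩
    x * (y * y)  ≈⟨ *-assoc x y y ⟨
    x * y * y    ≈⟨ *-congʳ xy≈1 ⟩
    1# * y       ≈⟨ *-identityˡ y ⟩
    y            ∎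

  x/y*y≈x : ∀ x {y} → y ≉ 0# → (x / y) * y ≈ x
  x/y*y≈x x {y} y≉0 =
    trans (*-assoc x (y ⁻¹) y) (trans (*-congˡ (⁻¹-inverseˡ y≉0)) (*-identityʳ x))

  x^2≈x*x : ∀ x → x ^ 2 ≈ x * x
  x^2≈x*x x = *-congˡ (*-identityʳ x)

  -- Absolute values.

  0≤∣x∣ : ∀ x → 0# ≤ ∣ x ∣ᵃ
  0≤∣x∣ x with ≤.total 0# x
  ... | inj₁ 0≤x = ≤.trans 0≤x (x≤x⊔y x (- x))
  ... | inj₂ x≤0 = ≤.trans (x≤0⇒0≤-x x≤0) (x≤y⊔x x (- x))

  x≤∣x∣ : ∀ x → x ≤ ∣ x ∣ᵃ
  x≤∣x∣ x = x≤x⊔y x (- x)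

  -- Together with `0≤∣x∣` this determines the absolute value, so congruence and multiplicativity
  -- follow by comparing squares, without cases on signs.
  ∣x∣*∣x∣≈x*x : ∀ x → ∣ x ∣ᵃ * ∣ x ∣ᵃ ≈ x * x
  ∣x∣*∣x∣≈x*x x with Max.⊔-sel totalOrder x (- x)
  ... | inj₁ eq = *-cong eq eq
  ... | inj₂ eq = trans (*-cong eq eq) (-x*-x≈x*x x)

  ∣∣-cong : ∀ {x y} → x ≈ y → ∣ x ∣ᵃ ≈ ∣ y ∣ᵃ
  ∣∣-cong {x} {y} x≈y = x*x≈y*y⇒x≈y (0≤∣x∣ x) (0≤∣x∣ y)
    (trans (∣x∣*∣x∣≈x*x x) (trans (*-cong x≈y x≈y) (sym (∣x∣*∣x∣≈x*x y))))

  ∣x*y∣≈∣x∣*∣y∣ : ∀ x y → ∣ x * y ∣ᵃ ≈ ∣ x ∣ᵃ * ∣ y ∣ᵃ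
  ∣x*y∣≈∣x∣*∣y∣ x y = x*x≈y*y⇒x≈y (0≤∣x∣ _) (*-nonNeg (0≤∣x∣ x) (0≤∣x∣ y)) (begin-equality
    ∣ x * y ∣ᵃ * ∣ x * y ∣ᵃ                ≈⟨ ∣x∣*∣x∣≈x*x (x * y) ⟩
    x * y * (x * y)                        ≈⟨ interchange x y ⟩
    x * x * (y * y)                        ≈⟨ *-cong (∣x∣*∣x∣≈x*x x) (∣x∣*∣x∣≈x*x y) ⟨
    ∣ x ∣ᵃ * ∣ x ∣ᵃ * (∣ y ∣ᵃ * ∣ y ∣ᵃ)    ≈⟨ interchange ∣ x ∣ᵃ ∣ y ∣ᵃ ⟨
    ∣ x ∣ᵃ * ∣ y ∣ᵃ * (∣ x ∣ᵃ * ∣ y ∣ᵃ)    ∎)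
    where
    interchange : ∀ a b → a * b * (a * b) ≈ a * a * (b * b)
    interchange = solve 2 (λ a b → a :* b :* (a :* b) := a :* a :* (b :* b)) refl

  x≈0⇒∣x∣≤y : ∀ {x y} → x ≈ 0# → 0# ≤ y → ∣ x ∣ᵃ ≤ y
  x≈0⇒∣x∣≤y {x} {y} x≈0 0≤y = x*x≤y*y⇒x≤y 0≤y (begin
    ∣ x ∣ᵃ * ∣ x ∣ᵃ  ≈⟨ ∣x∣*∣x∣≈x*x x ⟩
    x * x            ≈⟨ *-cong x≈0 x≈0 ⟩
    0# * 0#          ≈⟨ zeroˡ 0# ⟩
    0#               ≤⟨ 0≤x*x y ⟩
    y * y            ∎)

  -- Comparison of square roots with one.

  x≤1⇒√x≤1 : ∀ {x} → x ≤ 1# → √ x ≤ 1#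
  x≤1⇒√x≤1 {x} x≤1 = proj₂ (proj₂ (supremum (SquareBelow x) _ _)) 1# bound
    where
    bound : IsUpperBound (SquareBelow x) 1#
    bound y (inj₁ y≈0)  = ≤.≤-respˡ-≈ (sym y≈0) 0≤1
    bound y (inj₂ y²≤x) =
      x*x≤y*y⇒x≤y 0≤1 (≤.trans y²≤x (≤.trans x≤1 (≈⇒≤ (sym (*-identityˡ 1#)))))

  √-upperBound : ∀ {x y} → y * y ≤ x → y ≤ √ x
  √-upperBound {x} {y} y²≤x = proj₁ (proj₂ (supremum (SquareBelow x) _ _)) y (inj₂ y²≤x)

  -- The two sides differ by the square of `d = x - y`. Substituting `y + d` for `x` leaves an
  -- identity without subtraction, as the semiring solver requires.
  2xy≤x²+y² : ∀ x y → x * y + x * y ≤ x * x + y * y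
  2xy≤x²+y² x y = begin
    x * y + x * y                          ≤⟨ x≤x+y _ (0≤x*x d) ⟩
    x * y + x * y + d * d                  ≈⟨ +-congʳ (+-cong (*-congʳ x≈y+d) (*-congʳ x≈y+d)) ⟩
    (y + d) * y + (y + d) * y + d * d      ≈⟨ solve 2 (λ y d → (y :+ d) :* y :+ (y :+ d) :* y :+ d :* d := (y :+ d) :* (y :+ d) :+ y :* y) refl y d ⟩
    (y + d) * (y + d) + y * y              ≈⟨ +-congʳ (*-cong x≈y+d x≈y+d) ⟨
    x * x + y * y                          ∎
    where
    d = x - y
    x≈y+d : x ≈ y + d
    x≈y+d = sym (x+[y-x]≈y y x)

  0<1+x : ∀ {x} → 0# ≤ x → 0# < 1# + x
  0<1+x {x} 0≤x = 0≤x+y 0≤1 0≤x , λ 0≈1+x →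
    0≉1 (≤.antisym 0≤1 (≤.trans (x≤x+y 1# 0≤x) (≈⇒≤ (sym 0≈1+x))))

  -- The harmonic mean h = 2x/(1+x) of 1 and x has h² ≤ x, so h ≤ √ x ≤ 1,
  -- which is x ≤ 1.
  √x≤1⇒x≤1 : ∀ {x} → √ x ≤ 1# → x ≤ 1#
  √x≤1⇒x≤1 {x} √x≤1 = [ id , 1≤x⇒x≤1 ]′ (≤.total x 1#)
    where
    1≤x⇒x≤1 : 1# ≤ x → x ≤ 1#
    1≤x⇒x≤1 1≤x = +-cancelˡ-≤ x (begin
      x + x          ≈⟨ x/y*y≈x (x + x) (proj₂ 0<1+x′ ∘ sym) ⟨
      h * (1# + x)   ≤⟨ *-monoʳ-≤ (proj₁ 0<1+x′) (≤.trans (√-upperBound h²≤x) √x≤1) ⟩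
      1# * (1# + x)  ≈⟨ *-identityˡ (1# + x) ⟩
      1# + x         ≈⟨ +-comm 1# x ⟩
      x + 1#         ∎)
      where
      0<1+x′ : 0# < 1# + x
      0<1+x′ = 0<1+x (≤.trans 0≤1 1≤x)

      h = (x + x) / (1# + x)

      h²≤x : h * h ≤ x
      -- Multiplied by `(1 + x)²` the claim reads `(2x)² ≤ x (1 + x)²`, which is `x` times
      -- `4x ≤ (1 + x)²`.
      h²≤x = *-cancelˡ-≤ 0<1+x′ (*-cancelˡ-≤ 0<1+x′ (begin
        (1# + x) * ((1# + x) * (h * h))        ≈⟨ solve 2 (λ h e → e :* (e :* (h :* h)) := (h :* e) :* (h :* e)) refl h (1# + x) ⟩
        (h * (1# + x)) * (h * (1# + x))        ≈⟨ *-cong 2x≈ 2x≈ ⟩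
        (x + x) * (x + x)                      ≈⟨ solve 1 (λ x → (x :+ x) :* (x :+ x) := x :* (x :+ x :+ (x :* con 1 :+ x :* con 1))) refl x ⟩
        x * (x + x + (x * 1# + x * 1#)) ≤⟨ *-monoˡ-≤ (≤.trans 0≤1 1≤x) (+-monoʳ-≤ (x + x) (2xy≤x²+y² x (1#))) ⟩
        x * (x + x + (x * x + 1# * 1#)) ≈⟨ solve 1 (λ x → x :* (x :+ x :+ (x :* x :+ con 1 :* con 1)) := (con 1 :+ x) :* ((con 1 :+ x) :* x)) refl x ⟩
        (1# + x) * ((1# + x) * x)              ∎))
        where
        2x≈ : h * (1# + x) ≈ x + x
        2x≈ = x/y*y≈x (x + x) (proj₂ 0<1+x′ ∘ sym)

  -- Finite sums and natural multiples of one.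

  sum-mono-≤ : ∀ {n} {f g : Vector Carrier n} → (∀ i → f i ≤ g i) → sum f ≤ sum g
  sum-mono-≤ {ℕ.zero}  f≤g = ≤.refl
  sum-mono-≤ {ℕ.suc n} f≤g = +-mono-≤ (f≤g zero) (sum-mono-≤ (f≤g ∘ suc))

  0≤sum : ∀ {n} {f : Vector Carrier n} → (∀ i → 0# ≤ f i) → 0# ≤ sum f
  0≤sum {n} 0≤f = ≤.≤-respˡ-≈ (sum-replicate-zero n) (sum-mono-≤ 0≤f)

  fi≤sum : ∀ {n} {f : Vector Carrier n} → (∀ i → 0# ≤ f i) → ∀ i → f i ≤ sum f
  fi≤sum {f = f} 0≤f zero    = x≤x+y (f zero) (0≤sum (0≤f ∘ suc))
  fi≤sum {f = f} 0≤f (suc i) =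
    ≤.trans (fi≤sum (0≤f ∘ suc) i) (≤.trans (x≤x+y _ (0≤f zero)) (≈⇒≤ (+-comm _ _)))

  sum-*-sum : ∀ {m n} (f : Vector Carrier m) (g : Vector Carrier n) →
              sum (λ i → sum λ j → f i * g j) ≈ sum f * sum g
  sum-*-sum f g = begin-equality
    sum (λ i → sum λ j → f i * g j)  ≈⟨ sum-cong-≋ (λ i → *-distribˡ-sum (f i) g) ⟨
    sum (λ i → f i * sum g)          ≈⟨ *-distribʳ-sum (sum g) f ⟨
    sum f * sum g                    ∎

  0≤fromℕ : ∀ m → 0# ≤ fromℕ m
  0≤fromℕ ℕ.zero    = ≤.refl
  0≤fromℕ (ℕ.suc m) = 0≤x+y 0≤1 (0≤fromℕ m)

  fromℕ-mono-≤ : ∀ {l m} → l ℕ.≤ m → fromℕ l ≤ fromℕ m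
  fromℕ-mono-≤ {m = m} z≤n = 0≤fromℕ m
  fromℕ-mono-≤ (s≤s l≤m)   = +-monoʳ-≤ 1# (fromℕ-mono-≤ l≤m)

  fromℕ-9 : fromℕ 9 ≈ fromℕ 3 * fromℕ 3
  fromℕ-9 = ×1-homo-* 3 3

  -- Terms outside `p` are dropped and each term inside is lowered to `c`. With `p` the set of kept
  -- coordinates, this bounds a discarded coordinate by their average.
  ∣p∣*c≤sum : ∀ {n} (p : Subset n) {f : Vector Carrier n} {c} → (∀ i → 0# ≤ f i) →
              (∀ i → i ∈ p → c ≤ f i) → fromℕ ∣ p ∣ * c ≤ sum f
  ∣p∣*c≤sum []            {c = c} 0≤f c≤f = ≈⇒≤ (zeroˡ c)
  ∣p∣*c≤sum (outside ∷ p) {f} {c} 0≤f c≤f = begin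
    fromℕ ∣ p ∣ * c        ≤⟨ ∣p∣*c≤sum p (0≤f ∘ suc) (λ i i∈p → c≤f (suc i) (there i∈p)) ⟩
    sum (f ∘ suc)          ≈⟨ +-identityˡ _ ⟨
    0# + sum (f ∘ suc)     ≤⟨ +-mono-≤ (0≤f zero) ≤.refl ⟩
    f zero + sum (f ∘ suc) ∎
  ∣p∣*c≤sum (inside ∷ p) {f} {c} 0≤f c≤f = begin
    (1# + fromℕ ∣ p ∣) * c     ≈⟨ distribʳ c 1# (fromℕ ∣ p ∣) ⟩
    1# * c + fromℕ ∣ p ∣ * c   ≈⟨ +-congʳ (*-identityˡ c) ⟩
    c + fromℕ ∣ p ∣ * c        ≤⟨ +-mono-≤ (c≤f zero here)
                                  (∣p∣*c≤sum p (0≤f ∘ suc) (λ i i∈p → c≤f (suc i) (there i∈p))) ⟩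
    f zero + sum (f ∘ suc)     ∎

-- Dot products, bilinear and quadratic forms.

module LinearAlgebra (ℝ : CompleteOrderedField) where

  open SparsePCA ℝ hiding (zero)
  open OrderedField ℝ
  open ≤-Reasoning
  open RingProperties ring using (-0#≈0#)
  open SemiringSum semiring hiding (sum)
  open SemiringSolver commutativeSemiring using (solve; _:+_; _:*_; _:=_; con)

  dot-cong : ∀ {n} {x x′ y y′ : Vector Carrier n} → x ≋ x′ → y ≋ y′ → dot x y ≈ dot x′ y′
  dot-cong x≋x′ y≋y′ = sum-cong-≋ λ i → *-cong (x≋x′ i) (y≋y′ i)

  0≤dot : ∀ {n} (x : Vector Carrier n) → 0# ≤ dot x x
  0≤dot x = 0≤sum λ i → 0≤x*x (x i)

  dot-+ˡ : ∀ {n} (x y z : Vector Carrier n) → dot (λ i → x i + y i) z ≈ dot x z + dot y z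
  dot-+ˡ x y z = trans (sum-cong-≋ λ i → distribʳ (z i) (x i) (y i))
                       (∑-distrib-+ (λ i → x i * z i) (λ i → y i * z i))

  dot-+ʳ : ∀ {n} (x y z : Vector Carrier n) → dot x (λ i → y i + z i) ≈ dot x y + dot x z
  dot-+ʳ x y z = trans (sum-cong-≋ λ i → distribˡ (x i) (y i) (z i))
                       (∑-distrib-+ (λ i → x i * y i) (λ i → x i * z i))

  bilinearForm : ∀ {n} → Matrix n → Vector Carrier n → Vector Carrier n → Carrier
  bilinearForm M x y = dot x (M *ₘᵥ y)

  bilinearForm-cong : ∀ {n} (M : Matrix n) {x x′ y y′} → x ≋ x′ → y ≋ y′ →
                      bilinearForm M x y ≈ bilinearForm M x′ y′
  bilinearForm-cong M x≋x′ y≋y′ = dot-cong x≋x′ λ i → dot-cong (λ j → refl {M i j}) y≋y′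

  bilinearForm-+ˡ : ∀ {n} (M : Matrix n) x y z →
                    bilinearForm M (λ i → x i + y i) z ≈ bilinearForm M x z + bilinearForm M y z
  bilinearForm-+ˡ M x y z = dot-+ˡ x y (M *ₘᵥ z)

  bilinearForm-+ʳ : ∀ {n} (M : Matrix n) x y z →
                    bilinearForm M x (λ i → y i + z i) ≈ bilinearForm M x y + bilinearForm M x z
  bilinearForm-+ʳ M x y z =
    trans (dot-cong (λ _ → refl) (λ i → dot-+ʳ (M i) y z)) (dot-+ʳ x (M *ₘᵥ y) (M *ₘᵥ z))

  bilinearForm-∑∑ : ∀ {n} (M : Matrix n) x y →
                    bilinearForm M x y ≈ sum λ i → sum λ j → x i * (M i j * y j)
  bilinearForm-∑∑ M x y = sum-cong-≋ λ i → *-distribˡ-sum (x i) (λ j → M i j * y j)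

  bilinearForm-sym : ∀ {n} {M : Matrix n} → IsSymmetric M → ∀ x y →
                     bilinearForm M x y ≈ bilinearForm M y x
  bilinearForm-sym {M = M} M-sym x y = begin-equality
    bilinearForm M x y                        ≈⟨ bilinearForm-∑∑ M x y ⟩
    sum (λ i → sum λ j → x i * (M i j * y j)) ≈⟨ ∑-comm (λ i j → x i * (M i j * y j)) ⟩
    sum (λ j → sum λ i → x i * (M i j * y j)) ≈⟨ sum-cong-≋ (λ j → sum-cong-≋ λ i → swap i j) ⟩
    sum (λ j → sum λ i → y j * (M j i * x i)) ≈⟨ bilinearForm-∑∑ M y x ⟨
    bilinearForm M y x                        ∎
    where
    swap : ∀ i j → x i * (M i j * y j) ≈ y j * (M j i * x i)
    swap i j = trans (*-congˡ (*-congʳ (M-sym i j)))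
      (solve 3 (λ a b c → a :* (b :* c) := c :* (b :* a)) refl (x i) (M j i) (y j))

  -- The two cross terms stay separate because `M` is an arbitrary matrix here.
  quadraticForm-+ : ∀ {n} (M : Matrix n) x y → quadraticForm M (λ i → x i + y i) ≈
    (quadraticForm M x + bilinearForm M x y) + (bilinearForm M y x + quadraticForm M y)
  quadraticForm-+ M x y = begin-equality
    quadraticForm M x+y                         ≈⟨ bilinearForm-+ˡ M x y x+y ⟩
    bilinearForm M x x+y + bilinearForm M y x+y ≈⟨ +-cong (bilinearForm-+ʳ M x x y) (bilinearForm-+ʳ M y x y) ⟩
    (quadraticForm M x + bilinearForm M x y) + (bilinearForm M y x + quadraticForm M y) ∎
    where x+y = λ i → x i + y i

  -- Multiples of standard basis vectors and 2×2 principal minors.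

  at : ∀ {n} → Fin n → Carrier → Vector Carrier n
  at i c = updateAt 0ᵛ i λ _ → c

  dot-at : ∀ {n} (x : Vector Carrier n) i c → dot x (at i c) ≈ x i * c
  dot-at {ℕ.suc n} x zero c = begin-equality
    x zero * c + dot (x ∘ suc) 0ᵛ ≈⟨ +-congˡ (trans (sum-cong-≋ λ i → zeroʳ (x (suc i))) (sum-replicate-zero n)) ⟩
    x zero * c + 0#               ≈⟨ +-identityʳ _ ⟩
    x zero * c                    ∎
  dot-at x (suc i) c = begin-equality
    x zero * 0# + dot (x ∘ suc) (at i c) ≈⟨ +-cong (zeroʳ (x zero)) (dot-at (x ∘ suc) i c) ⟩
    0# + x (suc i) * c                   ≈⟨ +-identityˡ _ ⟩
    x (suc i) * c                        ∎

  bilinearForm-at : ∀ {n} (M : Matrix n) i a j b → bilinearForm M (at i a) (at j b) ≈ M i j * (a * b)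
  bilinearForm-at M i a j b = begin-equality
    dot (at i a) (M *ₘᵥ at j b)  ≈⟨ sum-cong-≋ (λ l → *-comm (at i a l) ((M *ₘᵥ at j b) l)) ⟩
    dot (M *ₘᵥ at j b) (at i a)  ≈⟨ dot-at (M *ₘᵥ at j b) i a ⟩
    dot (M i) (at j b) * a       ≈⟨ *-congʳ (dot-at (M i) j b) ⟩
    M i j * b * a                ≈⟨ solve 3 (λ m a b → m :* b :* a := m :* (a :* b)) refl (M i j) a b ⟩
    M i j * (a * b)              ∎

  -- The quadratic form is nonnegative at `a eᵢ − b eⱼ`. Expanding by bilinearity covers `i = j` as
  -- well.
  PSD⇒2×2-minor : ∀ {n} {M : Matrix n} → IsPSD M → ∀ i j a b →
    M i j * (a * b) + M j i * (a * b) ≤ M i i * (a * a) + M j j * (b * b)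
  PSD⇒2×2-minor {M = M} (_ , 0≤Q) i j a b = begin
    p * (a * b) + q * (a * b)                          ≤⟨ x≤x+y _ (0≤Q v) ⟩
    (p * (a * b) + q * (a * b)) + quadraticForm M v    ≈⟨ +-congˡ expand ⟩
    (p * (a * b) + q * (a * b)) + ((r * (a * a) + p * (a * - b)) + (q * (- b * a) + t * (- b * - b)))
      -- The semiring solver has no negation, so `- b` enters as a separate variable `c`; the cross
      -- terms collect into the factor `b - b`, which then vanishes.
      ≈⟨ solve 7 (λ p q r t a b c →
           (p :* (a :* b) :+ q :* (a :* b)) :+ ((r :* (a :* a) :+ p :* (a :* c)) :+ (q :* (c :* a) :+ t :* (c :* c)))
           := (p :+ q) :* (a :* (b :+ c)) :+ (r :* (a :* a) :+ t :* (c :* c))) refl p q r t a b (- b) ⟩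
    (p + q) * (a * (b - b)) + (r * (a * a) + t * (- b * - b))
      ≈⟨ +-cong (trans (*-congˡ (trans (*-congˡ (-‿inverseʳ b)) (zeroʳ a))) (zeroʳ (p + q)))
                (+-congˡ (*-congˡ (-x*-x≈x*x b))) ⟩
    0# + (r * (a * a) + t * (b * b))                   ≈⟨ +-identityˡ _ ⟩
    r * (a * a) + t * (b * b)                          ∎
    where
    p = M i j
    q = M j i
    r = M i i
    t = M j j
    v : Vector Carrier _
    v l = at i a l + at j (- b) l
    expand : quadraticForm M v ≈ (r * (a * a) + p * (a * - b)) + (q * (- b * a) + t * (- b * - b))
    expand = trans (quadraticForm-+ M (at i a) (at j (- b)))
      (+-cong (+-cong (bilinearForm-at M i a i a) (bilinearForm-at M i a j (- b)))
              (+-cong (bilinearForm-at M j (- b) i a) (bilinearForm-at M j (- b) j (- b))))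

  -- Summing M i i (v j)² + M j j (v i)² − 2 M i j (v i) (v j) ≥ 0 over all i and j.
  PSD⇒quadraticForm≤Tr*dot : ∀ {n} {M : Matrix n} → IsPSD M → ∀ v →
                             quadraticForm M v ≤ Tr M * dot v v
  PSD⇒quadraticForm≤Tr*dot {M = M} M-psd@(M-sym , _) v = x+x≤y+y⇒x≤y (begin
    quadraticForm M v + quadraticForm M v ≈⟨ +-cong (bilinearForm-∑∑ M v v) (bilinearForm-∑∑ M v v) ⟩
    ∑∑ (λ i j → v i * (M i j * v j)) + ∑∑ (λ i j → v i * (M i j * v j)) ≈⟨ ∑∑-+ _ _ ⟨
    ∑∑ (λ i j → v i * (M i j * v j) + v i * (M i j * v j))
      ≤⟨ sum-mono-≤ (λ i → sum-mono-≤ λ j → pointwise i j) ⟩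
    ∑∑ (λ i j → M i i * (v j * v j) + v i * v i * M j j) ≈⟨ ∑∑-+ _ _ ⟩
    ∑∑ (λ i j → M i i * (v j * v j)) + ∑∑ (λ i j → v i * v i * M j j)
      ≈⟨ +-cong (sum-*-sum (λ i → M i i) (λ j → v j * v j)) (sum-*-sum (λ i → v i * v i) (λ j → M j j)) ⟩
    Tr M * dot v v + dot v v * Tr M       ≈⟨ +-congˡ (*-comm _ _) ⟩
    Tr M * dot v v + Tr M * dot v v       ∎)
    where
    ∑∑ : Matrix _ → Carrier
    ∑∑ f = sum λ i → sum λ j → f i j
    ∑∑-+ : ∀ f g → ∑∑ (λ i j → f i j + g i j) ≈ ∑∑ f + ∑∑ g
    ∑∑-+ f g = trans (sum-cong-≋ λ i → ∑-distrib-+ (f i) (g i)) (∑-distrib-+ (sum ∘ f) (sum ∘ g))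
    pointwise : ∀ i j → v i * (M i j * v j) + v i * (M i j * v j) ≤
                        M i i * (v j * v j) + v i * v i * M j j
    pointwise i j = begin
      v i * (M i j * v j) + v i * (M i j * v j)  ≈⟨ +-congˡ (*-congˡ (*-congʳ (M-sym i j))) ⟩
      v i * (M i j * v j) + v i * (M j i * v j)
        ≈⟨ solve 4 (λ a b m n → a :* (m :* b) :+ a :* (n :* b) := m :* (b :* a) :+ n :* (b :* a)) refl (v i) (v j) (M i j) (M j i) ⟩
      -- The coefficients are crossed, `v j` at index `i` and `v i` at index `j`, so that the
      -- diagonal terms sum to the trace times the squared norm.
      M i j * (v j * v i) + M j i * (v j * v i)  ≤⟨ PSD⇒2×2-minor M-psd i j (v j) (v i) ⟩
      M i i * (v j * v j) + M j j * (v i * v i)  ≈⟨ +-congˡ (*-comm _ _) ⟩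
      M i i * (v j * v j) + v i * v i * M j j    ∎

  -- Rank-one matrices and the Cauchy-Schwarz inequality.

  outer : ∀ {n} → Vector Carrier n → Matrix n
  outer x i j = x i * x j

  quadraticForm-outer : ∀ {n} (x y : Vector Carrier n) → quadraticForm (outer x) y ≈ dot x y * dot x y
  quadraticForm-outer x y = begin-equality
    quadraticForm (outer x) y                        ≈⟨ bilinearForm-∑∑ (outer x) y y ⟩
    sum (λ i → sum λ j → y i * (x i * x j * y j))    ≈⟨ sum-cong-≋ (λ i → sum-cong-≋ λ j →
      solve 4 (λ a b c d → c :* (a :* b :* d) := a :* c :* (b :* d)) refl (x i) (x j) (y i) (y j)) ⟩
    sum (λ i → sum λ j → x i * y i * (x j * y j))    ≈⟨ sum-*-sum (λ i → x i * y i) (λ i → x i * y i) ⟩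
    dot x y * dot x y                                ∎

  outer-PSD : ∀ {n} (x : Vector Carrier n) → IsPSD (outer x)
  outer-PSD x = (λ i j → *-comm (x i) (x j)) ,
    λ y → ≤.≤-respʳ-≈ (sym (quadraticForm-outer x y)) (0≤x*x (dot x y))

  cauchySchwarz : ∀ {n} (x y : Vector Carrier n) → dot x y * dot x y ≤ dot x x * dot y y
  cauchySchwarz x y =
    ≤.≤-respˡ-≈ (quadraticForm-outer x y) (PSD⇒quadraticForm≤Tr*dot (outer-PSD x) y)

  -- Euclidean norms, 1-norms and support size.

  ∑^2≈dot : ∀ {n} (x : Vector Carrier n) → sum (λ i → x i ^ 2) ≈ dot x x
  ∑^2≈dot x = sum-cong-≋ λ i → x^2≈x*x (x i)

  ‖x‖₂≤1⇒dot≤1 : ∀ {n} (x : Vector Carrier n) → ‖ x ‖₂ ≤ 1# → dot x x ≤ 1#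
  ‖x‖₂≤1⇒dot≤1 x h = ≤.≤-respˡ-≈ (∑^2≈dot x) (√x≤1⇒x≤1 h)

  dot≤1⇒‖x‖₂≤1 : ∀ {n} (x : Vector Carrier n) → dot x x ≤ 1# → ‖ x ‖₂ ≤ 1#
  dot≤1⇒‖x‖₂≤1 x h = x≤1⇒√x≤1 (≤.≤-respˡ-≈ (sym (∑^2≈dot x)) h)

  ℓ₁ : ∀ {n} → Vector Carrier n → Carrier
  ℓ₁ x = sum λ i → ∣ x i ∣ᵃ

  0≤ℓ₁ : ∀ {n} (x : Vector Carrier n) → 0# ≤ ℓ₁ x
  0≤ℓ₁ x = 0≤sum λ i → 0≤∣x∣ (x i)

  module _ {n} {M : Matrix n} {x : Vector Carrier n} (M≈xxᵀ : ∀ i j → M i j ≈ x i * x j) where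

    rankOne-‖‖₁ : ‖ M ‖₁ ≈ ℓ₁ x * ℓ₁ x
    rankOne-‖‖₁ = trans
      (sum-cong-≋ λ i → sum-cong-≋ λ j → trans (∣∣-cong (M≈xxᵀ i j)) (∣x*y∣≈∣x∣*∣y∣ (x i) (x j)))
      (sum-*-sum (λ i → ∣ x i ∣ᵃ) (λ i → ∣ x i ∣ᵃ))

    rankOne-Tr : Tr M ≈ dot x x
    rankOne-Tr = sum-cong-≋ λ i → M≈xxᵀ i i

    -- The link between the objectives of the relaxation and of sparse PCA, used for `outer x` and
    -- for `Z₁`.
    Tr-*-rankOne : ∀ A → Tr (A *ₘ M) ≈ quadraticForm A x
    Tr-*-rankOne A = trans
      (sum-cong-≋ λ i → sum-cong-≋ λ j → trans (*-congˡ (M≈xxᵀ j i))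
        (solve 3 (λ a b c → a :* (b :* c) := c :* (a :* b)) refl (A i j) (x j) (x i)))
      (sym (bilinearForm-∑∑ A x x))

  Tr≤‖‖₁ : ∀ {n} (M : Matrix n) → Tr M ≤ ‖ M ‖₁
  Tr≤‖‖₁ M = sum-mono-≤ λ i → ≤.trans (x≤∣x∣ (M i i)) (fi≤sum (λ j → 0≤∣x∣ (M i j)) i)

  0≤‖‖₁ : ∀ {n} (M : Matrix n) → 0# ≤ ‖ M ‖₁
  0≤‖‖₁ M = 0≤sum λ i → 0≤sum λ j → 0≤∣x∣ (M i j)

  -- The indicator of the support, valued in the field so that Cauchy-Schwarz applies to it.
  nonzero : Carrier → Carrier
  nonzero a = if does (a ≤.≟ 0#) then 0# else 1#

  nonzero*∣x∣≈∣x∣ : ∀ x → nonzero x * ∣ x ∣ᵃ ≈ ∣ x ∣ᵃ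
  nonzero*∣x∣≈∣x∣ x with x ≤.≟ 0#
  ... | yes x≈0 = trans (zeroˡ _) (≤.antisym (0≤∣x∣ x) (x≈0⇒∣x∣≤y x≈0 ≤.refl))
  ... | no  _   = *-identityˡ _

  ‖x‖₀≈dot-nonzero : ∀ {n} (x : Vector Carrier n) →
                     fromℕ ‖ x ‖₀ ≈ dot (nonzero ∘ x) (nonzero ∘ x)
  ‖x‖₀≈dot-nonzero {ℕ.zero}  x = refl
  ‖x‖₀≈dot-nonzero {ℕ.suc n} x with does (x zero ≤.≟ 0#)
  ... | true  = trans (‖x‖₀≈dot-nonzero (x ∘ suc)) (sym (trans (+-congʳ (zeroˡ 0#)) (+-identityˡ _)))
  ... | false = +-cong (sym (*-identityˡ 1#)) (‖x‖₀≈dot-nonzero (x ∘ suc))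

  -- Cauchy-Schwarz for the absolute values of `x` and the indicator of its support.
  ℓ₁²≤‖x‖₀*dot : ∀ {n} (x : Vector Carrier n) → ℓ₁ x * ℓ₁ x ≤ fromℕ ‖ x ‖₀ * dot x x
  ℓ₁²≤‖x‖₀*dot x = begin
    ℓ₁ x * ℓ₁ x                      ≈⟨ *-cong ℓ₁≈ ℓ₁≈ ⟨
    dot ν ∣x∣ * dot ν ∣x∣            ≤⟨ cauchySchwarz ν ∣x∣ ⟩
    dot ν ν * dot ∣x∣ ∣x∣            ≈⟨ *-cong (sym (‖x‖₀≈dot-nonzero x)) (sum-cong-≋ λ i → ∣x∣*∣x∣≈x*x (x i)) ⟩
    fromℕ ‖ x ‖₀ * dot x x           ∎
    where
    ν = nonzero ∘ x
    ∣x∣ = ∣_∣ᵃ ∘ x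
    ℓ₁≈ : dot ν ∣x∣ ≈ ℓ₁ x
    ℓ₁≈ = sum-cong-≋ λ i → nonzero*∣x∣≈∣x∣ (x i)

  ‖z‖₀≤∣p∣ : ∀ {n} (p : Subset n) (z : Vector Carrier n) → (∀ i → i ∉ p → z i ≈ 0#) → ‖ z ‖₀ ℕ.≤ ∣ p ∣
  ‖z‖₀≤∣p∣ [] z z≈0 = z≤n
  ‖z‖₀≤∣p∣ (inside ∷ p) z z≈0 with does (z zero ≤.≟ 0#)
  ... | true  = ℕ.m≤n⇒m≤1+n (‖z‖₀≤∣p∣ p (z ∘ suc) λ i i∉p → z≈0 (suc i) (i∉p ∘ drop-there))
  ... | false = s≤s (‖z‖₀≤∣p∣ p (z ∘ suc) λ i i∉p → z≈0 (suc i) (i∉p ∘ drop-there))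
  ‖z‖₀≤∣p∣ (outside ∷ p) z z≈0 with z zero ≤.≟ 0#
  ... | yes _   = ‖z‖₀≤∣p∣ p (z ∘ suc) λ i i∉p → z≈0 (suc i) (i∉p ∘ drop-there)
  ... | no z₀≉0 = contradiction (z≈0 zero λ ()) z₀≉0

  -- Traces, feasibility for the relaxation and comparison of optimal values.

  IsPSD⇒0≤diagonal : ∀ {n} {M : Matrix n} → IsPSD M → ∀ i → 0# ≤ M i i
  IsPSD⇒0≤diagonal {M = M} (_ , 0≤Q) i = begin
    0#                        ≤⟨ 0≤Q (at i 1#) ⟩
    quadraticForm M (at i 1#) ≈⟨ bilinearForm-at M i 1# i 1# ⟩
    M i i * (1# * 1#)         ≈⟨ trans (*-congˡ (*-identityˡ 1#)) (*-identityʳ (M i i)) ⟩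
    M i i                     ∎

  -- Since `Z v = μ v`, the trace of `μ v vᵀ` equals `vᵀ Z v`, which is at most `Tr Z` times `vᵀ v`,
  -- and `v` is a unit vector.
  bestRankOne-Tr≤Tr : ∀ {n} {Z Z₁ : Matrix n} → IsPSD Z → IsBestRankOneApproximation Z Z₁ →
                      Tr Z₁ ≤ Tr Z
  bestRankOne-Tr≤Tr {Z = Z} {Z₁} Z-psd (μ , v , _ , (_ , Zv≋μv) , ‖v‖≈1 , Z₁≈μvvᵀ) = begin
    Tr Z₁               ≈⟨ sum-cong-≋ (λ i → trans (Z₁≈μvvᵀ i i) (rearrange i)) ⟩
    quadraticForm Z v   ≤⟨ PSD⇒quadraticForm≤Tr*dot Z-psd v ⟩
    Tr Z * dot v v      ≤⟨ *-monoˡ-≤ (0≤sum (IsPSD⇒0≤diagonal Z-psd)) (‖x‖₂≤1⇒dot≤1 v (≈⇒≤ ‖v‖≈1)) ⟩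
    Tr Z * 1#           ≈⟨ *-identityʳ (Tr Z) ⟩
    Tr Z                ∎
    where
    rearrange : ∀ i → μ * (v i * v i) ≈ v i * (Z *ₘᵥ v) i
    rearrange i = trans (solve 2 (λ m a → m :* (a :* a) := a :* (m :* a)) refl μ (v i))
                        (*-congˡ (sym (Zv≋μv i)))

  -- The trace of `x xᵀ` is the squared norm of `x`, and its entrywise 1-norm is `ℓ₁ x` squared,
  -- where sparsity enters through `ℓ₁²≤‖x‖₀*dot`.
  outer-feasible : ∀ {n} k {x : Vector Carrier n} → SPCAFeasible k x → SDPFeasible k (outer x)
  outer-feasible k {x} (‖x‖₂≤1 , ‖x‖₀≤k) = outer-PSD x , dot≤1 , (begin
    ‖ outer x ‖₁             ≈⟨ rankOne-‖‖₁ {x = x} (λ _ _ → refl) ⟩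
    ℓ₁ x * ℓ₁ x              ≤⟨ ℓ₁²≤‖x‖₀*dot x ⟩
    fromℕ ‖ x ‖₀ * dot x x   ≤⟨ *-mono-≤ (0≤fromℕ k) (0≤dot x) (fromℕ-mono-≤ ‖x‖₀≤k) dot≤1 ⟩
    fromℕ k * 1#             ≈⟨ *-identityʳ (fromℕ k) ⟩
    fromℕ k                  ∎)
    where
    dot≤1 = ‖x‖₂≤1⇒dot≤1 x ‖x‖₂≤1

  SPCAValue≤SDPValue : ∀ {n} {A Z : Matrix n} {k m} → IsSDPOptimal A k Z → IsSPCAValue A k m →
                       m ≤ Tr (A *ₘ Z)
  SPCAValue≤SDPValue {A = A} {Z} {k} {m} (_ , Z-max) (x , (x-feasible , _) , m≈) = begin
    m                    ≈⟨ m≈ ⟩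
    quadraticForm A x    ≈⟨ Tr-*-rankOne {x = x} (λ _ _ → refl) A ⟨
    Tr (A *ₘ outer x)    ≤⟨ Z-max (outer x) (outer-feasible k x-feasible) ⟩
    Tr (A *ₘ Z)          ∎

  -- Estimates for the perturbation of the quadratic form.

  -- Hölder's inequality for the 1-norm and the maximum norm. The scale `c` stays as a factor, so
  -- that the bound `r / c` on `y` is never formed.
  dot-Hölder : ∀ {n} (x y : Vector Carrier n) {c r} → 0# ≤ c → (∀ i → c * ∣ y i ∣ᵃ ≤ r) →
               c * dot x y ≤ ℓ₁ x * r
  dot-Hölder x y {c} {r} 0≤c c∣y∣≤r = begin
    c * dot x y                     ≈⟨ *-distribˡ-sum c (λ i → x i * y i) ⟩
    sum (λ i → c * (x i * y i))     ≤⟨ sum-mono-≤ pointwise ⟩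
    sum (λ i → ∣ x i ∣ᵃ * r)        ≈⟨ *-distribʳ-sum r (λ i → ∣ x i ∣ᵃ) ⟨
    ℓ₁ x * r                        ∎
    where
    pointwise : ∀ i → c * (x i * y i) ≤ ∣ x i ∣ᵃ * r
    pointwise i = begin
      c * (x i * y i)               ≤⟨ *-monoˡ-≤ 0≤c (x≤∣x∣ (x i * y i)) ⟩
      c * ∣ x i * y i ∣ᵃ            ≈⟨ *-congˡ (∣x*y∣≈∣x∣*∣y∣ (x i) (y i)) ⟩
      c * (∣ x i ∣ᵃ * ∣ y i ∣ᵃ)     ≈⟨ solve 3 (λ c a b → c :* (a :* b) := a :* (c :* b)) refl c ∣ x i ∣ᵃ ∣ y i ∣ᵃ ⟩
      ∣ x i ∣ᵃ * (c * ∣ y i ∣ᵃ)     ≤⟨ *-monoˡ-≤ (0≤∣x∣ (x i)) (c∣y∣≤r i) ⟩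
      ∣ x i ∣ᵃ * r                  ∎

  -- Cauchy-Schwarz for `w` and the `i`-th row of `A`.
  unitRows⇒∣*ₘᵥ∣²≤dot : ∀ {n} {A : Matrix n} → HasUnitRows A → ∀ w i →
                        (A *ₘᵥ w) i * (A *ₘᵥ w) i ≤ dot w w
  unitRows⇒∣*ₘᵥ∣²≤dot {A = A} A-unit w i = begin
    dot (A i) w * dot (A i) w     ≤⟨ cauchySchwarz (A i) w ⟩
    dot (A i) (A i) * dot w w     ≤⟨ *-monoʳ-≤ (0≤dot w) (‖x‖₂≤1⇒dot≤1 (A i) (≈⇒≤ (A-unit i))) ⟩
    1# * dot w w                  ≈⟨ *-identityˡ (dot w w) ⟩
    dot w w                       ∎

  -- Q(z + w) + Q(w) = Q(z) + 2 (z + w)ᵀ A w, and Q(w) ≥ 0.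
  quadraticForm-perturbation : ∀ {n} {A : Matrix n} → IsPSD A → ∀ {u z w} → u ≋ (λ i → z i + w i) →
    quadraticForm A u ≤ quadraticForm A z + (bilinearForm A u w + bilinearForm A u w)
  quadraticForm-perturbation {A = A} (A-sym , 0≤Q) {u} {z} {w} u≋z+w = begin
    quadraticForm A u                                       ≤⟨ x≤x+y _ (0≤Q w) ⟩
    quadraticForm A u + q                                   ≈⟨ +-congʳ (bilinearForm-cong A u≋z+w u≋z+w) ⟩
    quadraticForm A (λ i → z i + w i) + q                   ≈⟨ +-congʳ (quadraticForm-+ A z w) ⟩
    (quadraticForm A z + b) + (bilinearForm A w z + q) + q  ≈⟨ +-congʳ (+-congˡ (+-congʳ (bilinearForm-sym A-sym w z))) ⟩
    (quadraticForm A z + b) + (b + q) + q                   ≈⟨ solve 3 (λ p b q →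
      (p :+ b) :+ (b :+ q) :+ q := p :+ ((b :+ q) :+ (b :+ q))) refl (quadraticForm A z) b q ⟩
    quadraticForm A z + ((b + q) + (b + q))                 ≈⟨ +-congˡ (+-cong b+q≈ b+q≈) ⟩
    quadraticForm A z + (bilinearForm A u w + bilinearForm A u w) ∎
    where
    b = bilinearForm A z w
    q = quadraticForm A w
    b+q≈ : b + q ≈ bilinearForm A u w
    b+q≈ = sym (trans (bilinearForm-cong A u≋z+w (λ _ → refl)) (bilinearForm-+ˡ A z w w))

  -- Truncation to the largest coordinates.

  module Truncation {n} {s} {u z : Vector Carrier n} (z-top : IsTopTruncation s u z) where

    private
      S = proj₁ z-top
      ∣S∣≡s⊓n = proj₁ (proj₂ z-top)
      S-largest = proj₁ (proj₂ (proj₂ z-top))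
      z≈u = proj₁ (proj₂ (proj₂ (proj₂ z-top)))
      z≈0 = proj₂ (proj₂ (proj₂ (proj₂ z-top)))

    residual : Vector Carrier n
    residual i = u i - z i

    u≋z+residual : u ≋ λ i → z i + residual i
    u≋z+residual i = sym (x+[y-x]≈y (z i) (u i))

    ‖z‖₀≤s : ‖ z ‖₀ ℕ.≤ s
    ‖z‖₀≤s = ℕ.≤-trans (‖z‖₀≤∣p∣ S z z≈0) (ℕ.≤-trans (ℕ.≤-reflexive ∣S∣≡s⊓n) (ℕ.m⊓n≤m s n))

    dot-z≤dot-u : dot z z ≤ dot u u
    dot-z≤dot-u = sum-mono-≤ λ i → go i
      where
      go : ∀ i → z i * z i ≤ u i * u i
      go i with i ∈? S
      ... | yes i∈S = ≈⇒≤ (*-cong (z≈u i i∈S) (z≈u i i∈S))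
      ... | no  i∉S = begin
        z i * z i  ≈⟨ *-congʳ (z≈0 i i∉S) ⟩
        0# * z i   ≈⟨ zeroˡ (z i) ⟩
        0#         ≤⟨ 0≤x*x (u i) ⟩
        u i * u i  ∎

    private
      residual-∈ : ∀ {i} → i ∈ S → residual i ≈ 0#
      residual-∈ {i} i∈S = trans (+-congˡ (-‿cong (z≈u i i∈S))) (-‿inverseʳ (u i))

      residual-∉ : ∀ {i} → i ∉ S → residual i ≈ u i
      residual-∉ {i} i∉S =
        trans (+-congˡ (trans (-‿cong (z≈0 i i∉S)) -0#≈0#)) (+-identityʳ (u i))

      -- If the minimum of `s` and `n` were `n`, then `S` would contain every coordinate.
      i∉S⇒∣S∣≡s : ∀ {i} → i ∉ S → ∣ S ∣ ≡ s
      i∉S⇒∣S∣≡s {i} i∉S with ℕ.⊓-sel s n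
      ... | inj₁ s⊓n≡s = ≡.trans ∣S∣≡s⊓n s⊓n≡s
      ... | inj₂ s⊓n≡n =
        contradiction (≡.subst (i ∈_) (≡.sym (∣p∣≡n⇒p≡⊤ (≡.trans ∣S∣≡s⊓n s⊓n≡n))) ∈⊤) i∉S

    -- A discarded coordinate is dominated by each of the `s` kept ones, so `s` times its absolute
    -- value is at most `ℓ₁ u`. The bound is then linear in the coordinate and sums to `ℓ₁ u`
    -- squared.
    s*residual²≤ : ∀ i → fromℕ s * (residual i * residual i) ≤ ℓ₁ u * ∣ u i ∣ᵃ
    s*residual²≤ i with i ∈? S
    ... | yes i∈S = begin
      fromℕ s * (residual i * residual i)   ≈⟨ *-congˡ (trans (*-congʳ (residual-∈ i∈S)) (zeroˡ _)) ⟩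
      fromℕ s * 0#                          ≈⟨ zeroʳ _ ⟩
      0#                                    ≤⟨ *-nonNeg (0≤ℓ₁ u) (0≤∣x∣ (u i)) ⟩
      ℓ₁ u * ∣ u i ∣ᵃ                       ∎
    ... | no i∉S = begin
      fromℕ s * (residual i * residual i)   ≈⟨ *-congˡ (*-cong (residual-∉ i∉S) (residual-∉ i∉S)) ⟩
      fromℕ s * (u i * u i)                 ≈⟨ *-congˡ (∣x∣*∣x∣≈x*x (u i)) ⟨
      fromℕ s * (∣ u i ∣ᵃ * ∣ u i ∣ᵃ)       ≈⟨ *-assoc _ _ _ ⟨
      fromℕ s * ∣ u i ∣ᵃ * ∣ u i ∣ᵃ         ≡⟨ ≡.cong (λ m → fromℕ m * ∣ u i ∣ᵃ * ∣ u i ∣ᵃ) (i∉S⇒∣S∣≡s i∉S) ⟨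
      fromℕ ∣ S ∣ * ∣ u i ∣ᵃ * ∣ u i ∣ᵃ     ≤⟨ *-monoʳ-≤ (0≤∣x∣ (u i))
        (∣p∣*c≤sum S (λ j → 0≤∣x∣ (u j)) (λ j j∈S → S-largest j i j∈S i∉S)) ⟩
      ℓ₁ u * ∣ u i ∣ᵃ                       ∎

    s*dot-residual≤ℓ₁² : fromℕ s * dot residual residual ≤ ℓ₁ u * ℓ₁ u
    s*dot-residual≤ℓ₁² = begin
      fromℕ s * dot residual residual                  ≈⟨ *-distribˡ-sum (fromℕ s) (λ i → residual i * residual i) ⟩
      sum (λ i → fromℕ s * (residual i * residual i))  ≤⟨ sum-mono-≤ s*residual²≤ ⟩
      sum (λ i → ℓ₁ u * ∣ u i ∣ᵃ)                      ≈⟨ *-distribˡ-sum (ℓ₁ u) (λ i → ∣ u i ∣ᵃ) ⟨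
      ℓ₁ u * ℓ₁ u                                      ∎

  -- The bound on the loss.

  0≤norm-ratio : ∀ {n} (Z₁ Z : Matrix n) → 0# ≤ ‖ Z₁ ‖₁ / ‖ Z ‖₁
  0≤norm-ratio Z₁ Z = *-nonNeg (0≤‖‖₁ Z₁) (0≤x⁻¹ (0≤‖‖₁ Z))

  -- The left side is the entrywise 1-norm of `Z₁`, that is, the norm ratio times the norm of `Z`;
  -- these factors are at most `β` and `k`.
  ℓ₁²≤k*β : ∀ {n} {Z Z₁ : Matrix n} {u : Vector Carrier n} {k β} → SDPFeasible k Z → Tr Z₁ ≤ Tr Z →
            β ≥ ‖ Z₁ ‖₁ / ‖ Z ‖₁ → (∀ i j → Z₁ i j ≈ u i * u j) →
            ℓ₁ u * ℓ₁ u ≤ fromℕ k * β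
  ℓ₁²≤k*β {Z = Z} {Z₁} {u} {k} {β} (_ , _ , ‖Z‖≤k) TrZ₁≤TrZ ratio≤β Z₁≈uuᵀ = by-cases (‖ Z ‖₁ ≤.≟ 0#)
    where
    by-cases : Dec (‖ Z ‖₁ ≈ 0#) → ℓ₁ u * ℓ₁ u ≤ fromℕ k * β
    by-cases (no ‖Z‖≉0) = begin
      ℓ₁ u * ℓ₁ u                     ≈⟨ rankOne-‖‖₁ {x = u} Z₁≈uuᵀ ⟨
      ‖ Z₁ ‖₁                         ≈⟨ x/y*y≈x ‖ Z₁ ‖₁ ‖Z‖≉0 ⟨
      ‖ Z₁ ‖₁ / ‖ Z ‖₁ * ‖ Z ‖₁       ≤⟨ *-mono-≤ (≤.trans (0≤norm-ratio Z₁ Z) ratio≤β) (0≤‖‖₁ Z) ratio≤β ‖Z‖≤k ⟩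
      β * fromℕ k                     ≈⟨ *-comm β (fromℕ k) ⟩
      fromℕ k * β                     ∎
    -- The ratio now has the junk value 0 and does not control `‖ Z₁ ‖₁`. The trace does: it forces
    -- `dot u u ≤ 0#`, hence `ℓ₁ u` vanishes.
    by-cases (yes ‖Z‖≈0) = begin
      ℓ₁ u * ℓ₁ u                     ≤⟨ ℓ₁²≤‖x‖₀*dot u ⟩
      fromℕ ‖ u ‖₀ * dot u u          ≤⟨ *-monoˡ-≤ (0≤fromℕ ‖ u ‖₀) dot≤0 ⟩
      fromℕ ‖ u ‖₀ * 0#               ≈⟨ zeroʳ _ ⟩
      0#                              ≤⟨ *-nonNeg (0≤fromℕ k) (≤.trans (0≤norm-ratio Z₁ Z) ratio≤β) ⟩
      fromℕ k * β                     ∎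
      where
      dot≤0 : dot u u ≤ 0#
      dot≤0 = begin
        dot u u   ≈⟨ rankOne-Tr {x = u} Z₁≈uuᵀ ⟨
        Tr Z₁     ≤⟨ TrZ₁≤TrZ ⟩
        Tr Z      ≤⟨ Tr≤‖‖₁ Z ⟩
        ‖ Z ‖₁    ≈⟨ ‖Z‖≈0 ⟩
        0#        ∎

  -- With c = 3kβ the choice of s reads s ε² = c², so c |(Aw)ᵢ| ≤ ε ‖u‖₁; if c = 0
  -- then u = 0.
  2*bilinearForm≤ε : ∀ {n} {A : Matrix n} {u w : Vector Carrier n} {s k β ε} →
    HasUnitRows A → 0# < ε → 0# ≤ β →
    fromℕ s * dot w w ≤ ℓ₁ u * ℓ₁ u →
    ℓ₁ u * ℓ₁ u ≤ fromℕ k * β →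
    fromℕ s ≈ sparsityBound k β ε →
    bilinearForm A u w + bilinearForm A u w ≤ ε
  2*bilinearForm≤ε {A = A} {u} {w} {s} {k} {β} {ε} A-unit (0≤ε , 0≉ε) 0≤β s*dot≤U² U²≤κ s≈bound
    with 0# ≤.≟ fromℕ 3 * (fromℕ k * β)
  ... | no 0≉c = *-cancelˡ-≤ (0≤c , 0≉c) (begin
    c * (b + b)            ≈⟨ distribˡ c b b ⟩
    c * b + c * b          ≤⟨ +-mono-≤ c*b≤ε*κ c*b≤ε*κ ⟩
    -- A third copy of `ε * κ` completes the sum to `c * ε`; the 3 in `c` is the root of the
    -- constant 9 in the choice of `s`.
    ε * κ + ε * κ          ≤⟨ x≤x+y _ (*-nonNeg 0≤ε 0≤κ) ⟩
    ε * κ + ε * κ + ε * κ  ≈⟨ solve 2 (λ e x → e :* x :+ e :* x :+ e :* x := con 3 :* x :* e) refl ε κ ⟩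
    (1# + 1# + 1#) * κ * ε ≈⟨ *-congʳ (*-congʳ 3≈) ⟩
    c * ε                  ∎)
    where
    U = ℓ₁ u
    κ = fromℕ k * β
    c = fromℕ 3 * κ
    b = bilinearForm A u w

    -- The solver's numeral 3 is nested to the left, while `fromℕ 3` is nested to the right and ends
    -- in `0#`.
    3≈ : 1# + 1# + 1# ≈ fromℕ 3
    3≈ = trans (+-assoc 1# 1# 1#) (+-congˡ (+-congˡ (sym (+-identityʳ 1#))))

    0≤κ : 0# ≤ κ
    0≤κ = *-nonNeg (0≤fromℕ k) 0≤β

    0≤c : 0# ≤ c
    0≤c = *-nonNeg (0≤fromℕ 3) 0≤κ

    s*ε²≈c² : fromℕ s * (ε * ε) ≈ c * c
    s*ε²≈c² = begin-equality
      fromℕ s * (ε * ε)                     ≈⟨ *-cong s≈bound (sym (x^2≈x*x ε)) ⟩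
      sparsityBound k β ε * ε ^ 2           ≈⟨ x/y*y≈x _ (λ ε²≈0 → 0≉ε (sym (x*x≈0⇒x≈0 (trans (sym (x^2≈x*x ε)) ε²≈0)))) ⟩
      fromℕ 9 * fromℕ k ^ 2 * β ^ 2         ≈⟨ *-cong (*-cong fromℕ-9 (x^2≈x*x (fromℕ k))) (x^2≈x*x β) ⟩
      fromℕ 3 * fromℕ 3 * (fromℕ k * fromℕ k) * (β * β) ≈⟨ solve 3 (λ t k b →
        t :* t :* (k :* k) :* (b :* b) := t :* (k :* b) :* (t :* (k :* b))) refl (fromℕ 3) (fromℕ k) β ⟩
      c * c                                 ∎

    -- On squares, `c² |(Aw)ᵢ|² ≤ c² wᵀw = ε² (s wᵀw) ≤ ε² U²`, so the root of `s` never appears.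
    c∣Aw∣≤ε*U : ∀ i → c * ∣ (A *ₘᵥ w) i ∣ᵃ ≤ ε * U
    c∣Aw∣≤ε*U i = x*x≤y*y⇒x≤y (*-nonNeg 0≤ε (0≤ℓ₁ u)) (begin
      c * a * (c * a)                     ≈⟨ square-* c a ⟩
      c * c * (a * a)                     ≈⟨ *-congˡ (∣x∣*∣x∣≈x*x t) ⟩
      c * c * (t * t)                     ≤⟨ *-monoˡ-≤ (0≤x*x c) (unitRows⇒∣*ₘᵥ∣²≤dot {A = A} A-unit w i) ⟩
      c * c * dot w w                     ≈⟨ *-congʳ s*ε²≈c² ⟨
      fromℕ s * (ε * ε) * dot w w         ≈⟨ solve 3 (λ s e d → s :* e :* d := e :* (s :* d)) refl (fromℕ s) (ε * ε) (dot w w) ⟩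
      ε * ε * (fromℕ s * dot w w)         ≤⟨ *-monoˡ-≤ (0≤x*x ε) s*dot≤U² ⟩
      ε * ε * (U * U)                     ≈⟨ square-* ε U ⟨
      ε * U * (ε * U)                     ∎)
      where
      t = (A *ₘᵥ w) i
      a = ∣ t ∣ᵃ
      square-* : ∀ x y → x * y * (x * y) ≈ x * x * (y * y)
      square-* = solve 2 (λ x y → x :* y :* (x :* y) := x :* x :* (y :* y)) refl

    c*b≤ε*κ : c * b ≤ ε * κ
    c*b≤ε*κ = begin
      c * b         ≤⟨ dot-Hölder u (A *ₘᵥ w) 0≤c c∣Aw∣≤ε*U ⟩
      U * (ε * U)   ≈⟨ solve 2 (λ e u → u :* (e :* u) := e :* (u :* u)) refl ε U ⟩
      ε * (U * U)   ≤⟨ *-monoˡ-≤ 0≤ε U²≤κ ⟩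
      ε * κ         ∎
  ... | yes 0≈c = ≤.trans (+-mono-≤ b≤0 b≤0) (≤.trans (≈⇒≤ (+-identityˡ 0#)) 0≤ε)
    where
    κ = fromℕ k * β
    b = bilinearForm A u w
    t = λ i → (A *ₘᵥ w) i

    κ≤0 : κ ≤ 0#
    κ≤0 = begin
      κ            ≈⟨ *-identityˡ κ ⟨
      1# * κ       ≤⟨ *-monoʳ-≤ (*-nonNeg (0≤fromℕ k) 0≤β) (x≤x+y 1# (0≤fromℕ 2)) ⟩
      fromℕ 3 * κ  ≈⟨ 0≈c ⟨
      0#           ∎

    U≈0 : ℓ₁ u ≈ 0#
    U≈0 = x*x≈0⇒x≈0 (≤.antisym (≤.trans U²≤κ κ≤0) (0≤x*x (ℓ₁ u)))

    b≤0 : b ≤ 0#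
    b≤0 = begin
      b              ≈⟨ *-identityˡ b ⟨
      -- As `ℓ₁ u` vanishes, any bound on the entries of `A w` serves, and `ℓ₁ t` is one.
      1# * b         ≤⟨ dot-Hölder u t 0≤1 (λ i → ≤.trans (≈⇒≤ (*-identityˡ _)) (fi≤sum (λ j → 0≤∣x∣ (t j)) i)) ⟩
      ℓ₁ u * ℓ₁ t    ≈⟨ *-congʳ U≈0 ⟩
      0# * ℓ₁ t      ≈⟨ zeroˡ (ℓ₁ t) ⟩
      0#             ∎

-- Sparsity, norm and objective value of the truncated vector.

theorem3p1 : (ℝ : CompleteOrderedField) → let open SparsePCA ℝ in
    {n : ℕ} (A : Matrix n) (k : ℕ) (ε : Carrier) →
    IsPSD A →
    HasUnitRows A →
    HasUnitRows (A ᵀ) →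
    1 ℕ.≤ k →
    0# < ε →
    (Z Z₁ : Matrix n) →
    IsSDPOptimal A k Z →
    IsBestRankOneApproximation Z Z₁ →
    (α β : Carrier) →
    α ≥ 1# →
    Tr (A *ₘ Z) ≤ α * Tr (A *ₘ Z₁) →
    β ≥ ‖ Z₁ ‖₁ / ‖ Z ‖₁ →
    (s : ℕ) →
    fromℕ s ≈ sparsityBound k β ε →
    (u z : Vector Carrier n) →
    (∀ i j → Z₁ i j ≈ u i * u j) →
    IsTopTruncation s u z →
    (𝒵* : Carrier) →
    IsSPCAValue A k 𝒵* →
    fromℕ ‖ z ‖₀ ≤ sparsityBound k β ε ×
    ‖ z ‖₂ ≤ 1# ×
    quadraticForm A z ≥ (1# / α) * 𝒵* - ε
theorem3p1 ℝ A k ε A-psd A-unit _ _ 0<ε Z Z₁ Z-opt@(Z-feasible@(Z-psd , TrZ≤1 , _) , _) Z₁-best α β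
  1≤α TrAZ≤αTrAZ₁ ratio≤β s s≈bound u z Z₁≈uuᵀ z-top 𝒵* 𝒵*-value =
  ≤.trans (fromℕ-mono-≤ ‖z‖₀≤s) (≈⇒≤ s≈bound) ,
  dot≤1⇒‖x‖₂≤1 z (≤.trans dot-z≤dot-u dot-u≤1) ,
  (begin
    (1# / α) * 𝒵* - ε         ≤⟨ +-mono-≤ 𝒵*/α≤ ≤.refl ⟩
    quadraticForm A z + ε - ε ≈⟨ +-assoc _ _ _ ⟩
    quadraticForm A z + (ε - ε) ≈⟨ +-congˡ (-‿inverseʳ ε) ⟩
    quadraticForm A z + 0#    ≈⟨ +-identityʳ _ ⟩
    quadraticForm A z         ∎)
  where
  open SparsePCA ℝ
  open OrderedField ℝ
  open LinearAlgebra ℝ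
  open Truncation z-top
  open ≤-Reasoning

  -- Ensures that `1# / α` is a genuine inverse and not the junk value.
  0<α : 0# < α
  0<α = ≤.trans 0≤1 1≤α , λ 0≈α → 0≉1 (≤.antisym 0≤1 (≤.trans 1≤α (≈⇒≤ (sym 0≈α))))

  TrZ₁≤TrZ : Tr Z₁ ≤ Tr Z
  TrZ₁≤TrZ = bestRankOne-Tr≤Tr Z-psd Z₁-best

  dot-u≤1 : dot u u ≤ 1#
  dot-u≤1 = ≤.trans (≈⇒≤ (sym (rankOne-Tr {x = u} Z₁≈uuᵀ))) (≤.trans TrZ₁≤TrZ TrZ≤1)

  𝒵*≤αQu : 𝒵* ≤ α * quadraticForm A u
  𝒵*≤αQu = begin
    𝒵*                     ≤⟨ SPCAValue≤SDPValue Z-opt 𝒵*-value ⟩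
    Tr (A *ₘ Z)            ≤⟨ TrAZ≤αTrAZ₁ ⟩
    α * Tr (A *ₘ Z₁)       ≈⟨ *-congˡ (Tr-*-rankOne {x = u} Z₁≈uuᵀ A) ⟩
    α * quadraticForm A u  ∎

  𝒵*/α≤ : (1# / α) * 𝒵* ≤ quadraticForm A z + ε
  𝒵*/α≤ = begin
    (1# / α) * 𝒵*                        ≤⟨ *-monoˡ-≤ (*-nonNeg 0≤1 (0≤x⁻¹ (proj₁ 0<α))) 𝒵*≤αQu ⟩
    (1# / α) * (α * quadraticForm A u)   ≈⟨ *-assoc _ _ _ ⟨
    (1# / α) * α * quadraticForm A u     ≈⟨ *-congʳ (x/y*y≈x 1# (proj₂ 0<α ∘ sym)) ⟩
    1# * quadraticForm A u               ≈⟨ *-identityˡ _ ⟩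
    -- With `w` the residual, the loss from `u` to `z` is at most `2 uᵀAw`, which the choice of `s`
    -- keeps below `ε`.
    quadraticForm A u                    ≤⟨ quadraticForm-perturbation A-psd u≋z+residual ⟩
    quadraticForm A z + (bilinearForm A u residual + bilinearForm A u residual)
      ≤⟨ +-monoʳ-≤ (quadraticForm A z) (2*bilinearForm≤ε {A = A} {u} {residual} {s} {k} A-unit 0<ε
           (≤.trans (0≤norm-ratio Z₁ Z) ratio≤β) s*dot-residual≤ℓ₁²
           (ℓ₁²≤k*β {Z = Z} {Z₁} {u} {k} Z-feasible TrZ₁≤TrZ ratio≤β Z₁≈uuᵀ) s≈bound) ⟩
    quadraticForm A z + ε                ∎
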